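{- Let $\pi:N\to N$ be a permutation and $m\in\mathbb{R}^{\mathcal{P}(N)}$. Then: (i) $m\in\mathcal{K}(N)$ if and only if $T_\pi(m)\in\mathcal{K}(N)$, and the independency model induced by $T_\pi(m)$ is determined as follows: for any $\langle a,b|C\rangle\in\mathcal{E}(N)$, $$a\perp b\mid C\ [T_\pi(m)]\iff \pi(a)\perp\pi(b)\mid \boldsymbol{\pi}(C)\ [m].$$ In particular, $T_\pi$ maps $\mathcal{K}(N)$ onto $\mathcal{K}(N)$. (ii) $T_\pi$ maps faces of $\mathcal{K}(N)$ to faces of $\mathcal{K}(N)$ and preserves inclusion: $G\subseteq F$ if and only if $T_\pi(G)\subseteq T_\pi(F)$ for any $G,F\subseteq\mathbb{R}^{\mathcal{P}(N)}$. In particular, $m\in\mathcal{K}(N)$ is extreme in $\mathcal{K}(N)$ if and only if $T_\pi(m)$ is extreme in $\mathcal{K}(N)$.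
   Context: $N$ is a finite set with $|N|\ge 2$ and $\mathcal{P}(N)$ is its power set; a singleton $\{a\}$ is written $a$. $\mathbb{R}^{\mathcal{P}(N)}$ is the space of functions $m:\mathcal{P}(N)\to\mathbb{R}$ with scalar product $\langle m,u\rangle=\sum_{A\subseteq N}m(A)u(A)$. A function $m$ is supermodular if $m(A)+m(B)\le m(A\cup B)+m(A\cap B)$ for all $A,B\subseteq N$; $\mathcal{K}(N)$ is the cone of supermodular functions. $\mathcal{E}(N)$ is the set of triplets $\langle a,b|C\rangle$ with $a,b\in N$ distinct and $C\subseteq N\setminus\{a,b\}$. For $m\in\mathbb{R}^{\mathcal{P}(N)}$, $a\perp b\mid C\ [m]$ means $m(a\cup b\cup C)+m(C)-m(a\cup C)-m(b\cup C)=0$. The independency model induced by $m\in\mathcal{K}(N)$ is the set of $\langle a,b|C\rangle\in\mathcal{E}(N)$ with $a\perp b\mid C\ [m]$. A face of a convex cone $K\subseteq\mathbb{R}^{\mathcal{P}(N)}$ is a set $\{m\in K: k=\langle m,v\rangle\}$, where $v\in\mathbb{R}^{\mathcal{P}(N)}$, $k\in\mathbb{R}$ satisfy $k\le\langle m,v\rangle$ for all $m\in K$. The non-empty faces of $\mathcal{K}(N)$ form a lattice under inclusion with least element the space of modular functions $\mathcal{K}(N)\cap(-\mathcal{K}(N))$. A function $m\in\mathcal{K}(N)$ is extreme in $\mathcal{K}(N)$ if the smallest face of $\mathcal{K}(N)$ containing $m$ is an atom of this lattice. For a permutation (bijection) $\pi:N\to N$ put $\boldsymbol{\pi}(S)=\{\pi(i):i\in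 S\}$ for $S\subseteq N$; the permutational transformation $T_\pi:\mathbb{R}^{\mathcal{P}(N)}\to\mathbb{R}^{\mathcal{P}(N)}$ is $[T_\pi(m)](S)=m(\boldsymbol{\pi}(S))$ for $S\subseteq N$. -}

module Defs where

open import Level using (0ℓ; _⊔_)
open import Data.Nat.Base as ℕ using (ℕ; zero; suc)
import Data.Nat.Properties as ℕ
open import Data.Rational.Base as ℚ using (ℚ; 0ℚ; 1ℚ; ∣_∣; 1/_)
import Data.Rational.Properties as ℚ
open import Data.Rational.Solver using (module +-*-Solver)
open import Data.Fin.Base using (Fin)
import Data.Fin.Properties as Fin
open import Data.Fin.Permutation using (Permutation′; _⟨$⟩ʳ_)
open import Data.Fin.Subset as Sub using (Subset; inside; outside; ⁅_⁆)
import Data.Fin.Subset.Properties as Sub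
open import Data.List.Base as List using (List; []; _∷_; _++_)
open import Data.Vec.Base as Vec using ([]; _∷_)
open import Data.Product.Base using (_×_; _,_; ∃; ∃-syntax; Σ-syntax)
open import Relation.Nullary.Negation using (¬_)
open import Relation.Nullary.Decidable using (does; _×-dec_)
open import Relation.Binary.Core using (Rel)
open import Relation.Binary.PropositionalEquality
  using (_≡_; _≢_; refl; sym; trans; cong; subst)
open import Relation.Unary using (Pred; _∈_; _⊆_; _⊂_; _≐_; Satisfiable)

------------------------------------------------------------------------
-- Real numbers: Cauchy sequences of rationals, as a setoid.

-- The modulus of convergence is part of the (constructive) existential.
IsCauchy : (ℕ → ℚ) → Set
IsCauchy x = ∀ ε → 0ℚ ℚ.< ε →
  ∃[ k ] (∀ i j → k ℕ.≤ i → k ℕ.≤ j → ∣ x i ℚ.- x j ∣ ℚ.≤ ε)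

record ℝ : Set where
  constructor mkℝ
  field
    seq    : ℕ → ℚ
    cauchy : IsCauchy seq

open ℝ public

infix 4 _≈_ _≤_

_≈_ : Rel ℝ 0ℓ
x ≈ y = ∀ ε → 0ℚ ℚ.< ε →
  ∃[ k ] (∀ i → k ℕ.≤ i → ∣ seq x i ℚ.- seq y i ∣ ℚ.≤ ε)

_≤_ : Rel ℝ 0ℓ
x ≤ y = ∀ ε → 0ℚ ℚ.< ε →
  ∃[ k ] (∀ i → k ℕ.≤ i → seq x i ℚ.≤ seq y i ℚ.+ ε)

private
  -- Division of ε by a positive bound.
  split : ∀ B ε → 0ℚ ℚ.< B → 0ℚ ℚ.< ε → ∃[ δ ] (0ℚ ℚ.< δ × B ℚ.* δ ≡ ε)
  split B ε 0<B 0<ε = (1/ B) ℚ.* ε , 0<δ , eq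
    where
    instance
      posB : ℚ.Positive B
      posB = ℚ.positive 0<B
      posε : ℚ.Positive ε
      posε = ℚ.positive 0<ε
      nzB : ℚ.NonZero B
      nzB = ℚ.pos⇒nonZero B
      pos1/B : ℚ.Positive (1/ B)
      pos1/B = ℚ.1/pos⇒pos B
    0<δ : 0ℚ ℚ.< (1/ B) ℚ.* ε
    0<δ = ℚ.positive⁻¹ _ {{ℚ.pos*pos⇒pos (1/ B) ε}}
    eq : B ℚ.* ((1/ B) ℚ.* ε) ≡ ε
    eq = trans (sym (ℚ.*-assoc B (1/ B) ε))
           (trans (cong (ℚ._* ε) (ℚ.*-inverseʳ B)) (ℚ.*-identityˡ ε))

  0<1 : 0ℚ ℚ.< 1ℚ
  0<1 = ℚ.positive⁻¹ 1ℚ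

  module _ where
    open +-*-Solver

    sum-diff : ∀ a b c d → (a ℚ.+ b) ℚ.- (c ℚ.+ d) ≡ (a ℚ.- c) ℚ.+ (b ℚ.- d)
    sum-diff = solve 4
      (λ a b c d → (a :+ b) :- (c :+ d) := (a :- c) :+ (b :- d)) refl

    neg-diff : ∀ a b → (ℚ.- a) ℚ.- (ℚ.- b) ≡ ℚ.- (a ℚ.- b)
    neg-diff = solve 2 (λ a b → (:- a) :- (:- b) := :- (a :- b)) refl

    prod-diff : ∀ a b c d →
      (a ℚ.* b) ℚ.- (c ℚ.* d) ≡ a ℚ.* (b ℚ.- d) ℚ.+ d ℚ.* (a ℚ.- c)
    prod-diff = solve 4
      (λ a b c d → (a :* b) :- (c :* d) := a :* (b :- d) :+ d :* (a :- c)) refl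

    from-diff : ∀ a b → a ≡ b ℚ.+ (a ℚ.- b)
    from-diff = solve 2 (λ a b → a := b :+ (a :- b)) refl

  two-halves : ∀ δ → δ ℚ.+ δ ≡ (1ℚ ℚ.+ 1ℚ) ℚ.* δ
  two-halves δ = sym (trans (ℚ.*-distribʳ-+ δ 1ℚ 1ℚ)
    (trans (cong (ℚ._+ (1ℚ ℚ.* δ)) (ℚ.*-identityˡ δ))
           (cong (δ ℚ.+_) (ℚ.*-identityˡ δ))))

  bounded : (x : ℝ) → ∃[ B ] (0ℚ ℚ.< B ×
              ∃[ k ] (∀ i → k ℕ.≤ i → ∣ seq x i ∣ ℚ.≤ B))
  bounded (mkℝ x cx) with cx 1ℚ 0<1
  ... | k , h = ∣ x k ∣ ℚ.+ 1ℚ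
              , ℚ.+-mono-≤-< (ℚ.0≤∣p∣ (x k)) 0<1
              , k , bound
    where
    open ℚ.≤-Reasoning
    bound : ∀ i → k ℕ.≤ i → ∣ x i ∣ ℚ.≤ ∣ x k ∣ ℚ.+ 1ℚ
    bound i k≤i = begin
      ∣ x i ∣                           ≡⟨ cong ∣_∣ (from-diff (x i) (x k)) ⟩
      ∣ x k ℚ.+ (x i ℚ.- x k) ∣         ≤⟨ ℚ.∣p+q∣≤∣p∣+∣q∣ (x k) (x i ℚ.- x k) ⟩
      ∣ x k ∣ ℚ.+ ∣ x i ℚ.- x k ∣       ≤⟨ ℚ.+-monoʳ-≤ ∣ x k ∣ (h i k k≤i ℕ.≤-refl) ⟩
      ∣ x k ∣ ℚ.+ 1ℚ                    ∎

  *-bound : ∀ p q {B δ} → ∣ p ∣ ℚ.≤ B → ∣ q ∣ ℚ.≤ δ → 0ℚ ℚ.< B →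
            ∣ p ℚ.* q ∣ ℚ.≤ B ℚ.* δ
  *-bound p q {B} {δ} p≤B q≤δ 0<B = begin
    ∣ p ℚ.* q ∣       ≡⟨ ℚ.∣p*q∣≡∣p∣*∣q∣ p q ⟩
    ∣ p ∣ ℚ.* ∣ q ∣   ≤⟨ ℚ.*-monoʳ-≤-nonNeg ∣ q ∣ {{ℚ.nonNegative (ℚ.0≤∣p∣ q)}} p≤B ⟩
    B ℚ.* ∣ q ∣       ≤⟨ ℚ.*-monoˡ-≤-nonNeg B {{ℚ.nonNegative (ℚ.<⇒≤ 0<B)}} q≤δ ⟩
    B ℚ.* δ           ∎
    where open ℚ.≤-Reasoning

infixl 6 _+_ _-_
infixl 7 _*_
infix  8 -_

fromℚ : ℚ → ℝ
fromℚ q = mkℝ (λ _ → q) λ ε 0<ε →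
  0 , λ _ _ _ _ →
    subst (λ p → ∣ p ∣ ℚ.≤ ε) (sym (ℚ.+-inverseʳ q)) (ℚ.<⇒≤ 0<ε)

0ℝ : ℝ
0ℝ = fromℚ 0ℚ

_+_ : ℝ → ℝ → ℝ
x + y = mkℝ (λ i → seq x i ℚ.+ seq y i) isCauchy
  where
  isCauchy : IsCauchy (λ i → seq x i ℚ.+ seq y i)
  isCauchy ε 0<ε with split (1ℚ ℚ.+ 1ℚ) ε (ℚ.positive⁻¹ _) 0<ε
  ... | δ , 0<δ , eq with cauchy x δ 0<δ | cauchy y δ 0<δ
  ... | k , hx | l , hy = k ℕ.⊔ l , λ i j ki kj → begin
    ∣ (seq x i ℚ.+ seq y i) ℚ.- (seq x j ℚ.+ seq y j) ∣
      ≡⟨ cong ∣_∣ (sum-diff (seq x i) (seq y i) (seq x j) (seq y j)) ⟩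
    ∣ (seq x i ℚ.- seq x j) ℚ.+ (seq y i ℚ.- seq y j) ∣
      ≤⟨ ℚ.∣p+q∣≤∣p∣+∣q∣ (seq x i ℚ.- seq x j) (seq y i ℚ.- seq y j) ⟩
    ∣ seq x i ℚ.- seq x j ∣ ℚ.+ ∣ seq y i ℚ.- seq y j ∣
      ≤⟨ ℚ.+-mono-≤
           (hx i j (ℕ.m⊔n≤o⇒m≤o k l ki) (ℕ.m⊔n≤o⇒m≤o k l kj))
           (hy i j (ℕ.m⊔n≤o⇒n≤o k l ki) (ℕ.m⊔n≤o⇒n≤o k l kj)) ⟩
    δ ℚ.+ δ
      ≡⟨ trans (two-halves δ) eq ⟩
    ε ∎
    where open ℚ.≤-Reasoning

-_ : ℝ → ℝ
- x = mkℝ (λ i → ℚ.- seq x i) isCauchy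
  where
  isCauchy : IsCauchy (λ i → ℚ.- seq x i)
  isCauchy ε 0<ε with cauchy x ε 0<ε
  ... | k , hx = k , λ i j ki kj → subst (ℚ._≤ ε)
    (sym (trans (cong ∣_∣ (neg-diff (seq x i) (seq x j)))
                (ℚ.∣-p∣≡∣p∣ (seq x i ℚ.- seq x j))))
    (hx i j ki kj)

_-_ : ℝ → ℝ → ℝ
x - y = x + (- y)

private
  *-step : ∀ a b c d {B C δ ε} →
    ∣ a ∣ ℚ.≤ B → ∣ d ∣ ℚ.≤ C → ∣ b ℚ.- d ∣ ℚ.≤ δ → ∣ a ℚ.- c ∣ ℚ.≤ δ →
    0ℚ ℚ.< B → 0ℚ ℚ.< C → (B ℚ.+ C) ℚ.* δ ≡ ε →
    ∣ a ℚ.* b ℚ.- c ℚ.* d ∣ ℚ.≤ ε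
  *-step a b c d {B} {C} {δ} {ε} a≤B d≤C bd≤δ ac≤δ 0<B 0<C eq = begin
    ∣ a ℚ.* b ℚ.- c ℚ.* d ∣
      ≡⟨ cong ∣_∣ (prod-diff a b c d) ⟩
    ∣ a ℚ.* (b ℚ.- d) ℚ.+ d ℚ.* (a ℚ.- c) ∣
      ≤⟨ ℚ.∣p+q∣≤∣p∣+∣q∣ (a ℚ.* (b ℚ.- d)) (d ℚ.* (a ℚ.- c)) ⟩
    ∣ a ℚ.* (b ℚ.- d) ∣ ℚ.+ ∣ d ℚ.* (a ℚ.- c) ∣
      ≤⟨ ℚ.+-mono-≤ (*-bound a (b ℚ.- d) a≤B bd≤δ 0<B)
                    (*-bound d (a ℚ.- c) d≤C ac≤δ 0<C) ⟩
    B ℚ.* δ ℚ.+ C ℚ.* δ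
      ≡⟨ trans (sym (ℚ.*-distribʳ-+ δ B C)) eq ⟩
    ε ∎
    where open ℚ.≤-Reasoning

_*_ : ℝ → ℝ → ℝ
x * y = mkℝ (λ i → seq x i ℚ.* seq y i) isCauchy
  where
  isCauchy : IsCauchy (λ i → seq x i ℚ.* seq y i)
  isCauchy ε 0<ε =
    let B , 0<B , k , hB = bounded x
        C , 0<C , l , hC = bounded y
        δ , 0<δ , eq = split (B ℚ.+ C) ε (ℚ.+-mono-< 0<B 0<C) 0<ε
        k′ , hx = cauchy x δ 0<δ
        l′ , hy = cauchy y δ 0<δ
    in (k ℕ.⊔ l) ℕ.⊔ (k′ ℕ.⊔ l′) , λ i j ki kj →
      let k⊔l≤i   = ℕ.m⊔n≤o⇒m≤o (k ℕ.⊔ l) (k′ ℕ.⊔ l′) ki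
          k⊔l≤j   = ℕ.m⊔n≤o⇒m≤o (k ℕ.⊔ l) (k′ ℕ.⊔ l′) kj
          k′⊔l′≤i = ℕ.m⊔n≤o⇒n≤o (k ℕ.⊔ l) (k′ ℕ.⊔ l′) ki
          k′⊔l′≤j = ℕ.m⊔n≤o⇒n≤o (k ℕ.⊔ l) (k′ ℕ.⊔ l′) kj
      in *-step (seq x i) (seq y i) (seq x j) (seq y j)
           (hB i (ℕ.m⊔n≤o⇒m≤o k l k⊔l≤i))
           (hC j (ℕ.m⊔n≤o⇒n≤o k l k⊔l≤j))
           (hy i j (ℕ.m⊔n≤o⇒n≤o k′ l′ k′⊔l′≤i) (ℕ.m⊔n≤o⇒n≤o k′ l′ k′⊔l′≤j))
           (hx i j (ℕ.m⊔n≤o⇒m≤o k′ l′ k′⊔l′≤i) (ℕ.m⊔n≤o⇒m≤o k′ l′ k′⊔l′≤j))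
           0<B 0<C eq

------------------------------------------------------------------------
-- Set functions on N = Fin n.

ℝ^𝒫 : ℕ → Set
ℝ^𝒫 n = Subset n → ℝ

infix 4 _≋_
_≋_ : ∀ {n} → Rel (ℝ^𝒫 n) 0ℓ
m ≋ m′ = ∀ S → m S ≈ m′ S

neg : ∀ {n} → ℝ^𝒫 n → ℝ^𝒫 n
neg m S = - m S

-- Lists every subset exactly once.
subsets : ∀ n → List (Subset n)
subsets zero    = [] ∷ []
subsets (suc n) = List.map (outside ∷_) (subsets n) ++
                  List.map (inside ∷_) (subsets n)

⟨_,_⟩ : ∀ {n} → ℝ^𝒫 n → ℝ^𝒫 n → ℝ
⟨_,_⟩ {n} m u = List.foldr _+_ 0ℝ (List.map (λ A → m A * u A) (subsets n))

-- Supermodular functions.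
𝓚 : ∀ {n} → Pred (ℝ^𝒫 n) 0ℓ
𝓚 m = ∀ A B → m A + m B ≤ m (A Sub.∪ B) + m (A Sub.∩ B)

-- Modular functions: 𝓚 ∩ (− 𝓚).
Modular : ∀ {n} → Pred (ℝ^𝒫 n) 0ℓ
Modular m = m ∈ 𝓚 × neg m ∈ 𝓚

------------------------------------------------------------------------
-- Independency models.

record 𝓔 (n : ℕ) : Set where
  constructor triplet
  field
    a b : Fin n
    C   : Subset n
    a≢b : a ≢ b
    a∉C : a Sub.∉ C
    b∉C : b Sub.∉ C

infix 4 _⊥_∣_[_]
_⊥_∣_[_] : ∀ {n} → Fin n → Fin n → Subset n → ℝ^𝒫 n → Set
a ⊥ b ∣ C [ m ] =
  m (⁅ a ⁆ Sub.∪ ⁅ b ⁆ Sub.∪ C) + m C - m (⁅ a ⁆ Sub.∪ C) - m (⁅ b ⁆ Sub.∪ C)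
    ≈ 0ℝ

independencyModel : ∀ {n} → ℝ^𝒫 n → Pred (𝓔 n) 0ℓ
independencyModel m t = 𝓔.a t ⊥ 𝓔.b t ∣ 𝓔.C t [ m ]

------------------------------------------------------------------------
-- Faces.

-- A subset of the setoid (ℝ^𝒫 n , _≋_) is a predicate respecting _≋_.
Extensional : ∀ {n ℓ} → Pred (ℝ^𝒫 n) ℓ → Set ℓ
Extensional G = ∀ {m m′} → m ≋ m′ → m ∈ G → m′ ∈ G

-- F is a face of K.  The empty set is allowed as a face.
_IsFaceOf_ : ∀ {n f ℓ} → Pred (ℝ^𝒫 n) f → Pred (ℝ^𝒫 n) ℓ → Set (f ⊔ ℓ)
_IsFaceOf_ {n} F K = Σ[ v ∈ ℝ^𝒫 n ] Σ[ k ∈ ℝ ]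
  ((∀ m → m ∈ K → k ≤ ⟨ m , v ⟩) ×
   F ≐ (λ m → m ∈ K × k ≈ ⟨ m , v ⟩))

IsNonEmptyFace : ∀ {n f} → Pred (ℝ^𝒫 n) f → Set f
IsNonEmptyFace F = F IsFaceOf 𝓚 × Satisfiable F

-- F covers the least element, Modular, of the lattice of non-empty faces.
IsAtom : ∀ {n} → Pred (ℝ^𝒫 n) 0ℓ → Set₁
IsAtom {n} F =
  IsNonEmptyFace F × Modular ⊂ F ×
  ¬ (Σ[ G ∈ Pred (ℝ^𝒫 n) 0ℓ ] (IsNonEmptyFace G × Modular ⊂ G × G ⊂ F))

IsSmallestFaceContaining : ∀ {n} → ℝ^𝒫 n → Pred (ℝ^𝒫 n) 0ℓ → Set₁
IsSmallestFaceContaining {n} m F =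
  F IsFaceOf 𝓚 × m ∈ F ×
  (∀ (G : Pred (ℝ^𝒫 n) 0ℓ) → G IsFaceOf 𝓚 → m ∈ G → F ⊆ G)

Extreme : ∀ {n} → ℝ^𝒫 n → Set₁
Extreme {n} m =
  Σ[ F ∈ Pred (ℝ^𝒫 n) 0ℓ ] (IsSmallestFaceContaining m F × IsAtom F)

------------------------------------------------------------------------
-- Permutational transformations.

-- Direct image { π(i) : i ∈ S }.
image : ∀ {n} → Permutation′ n → Subset n → Subset n
image π S = Vec.tabulate λ j →
  does (Fin.any? λ i → (i Sub.∈? S) ×-dec ((π ⟨$⟩ʳ i) Fin.≟ j))

T : ∀ {n} → Permutation′ n → ℝ^𝒫 n → ℝ^𝒫 n
T π m S = m (image π S)

-- Direct image of a set of functions, closed under _≋_.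
T[_]_ : ∀ {n ℓ} → Permutation′ n → Pred (ℝ^𝒫 n) ℓ → Pred (ℝ^𝒫 n) ℓ
(T[ π ] G) m′ = ∃[ m ] (m ∈ G × T π m ≋ m′)

{-# OPTIONS --safe #-}

-- T π and T (flip π) are mutually inverse up to ≋ and adjoint for the scalar
-- product, since π permutes the subsets of N.  As the image under π commutes
-- with ∪ and ∩, T π preserves 𝓚, and it carries the face of 𝓚 cut out by
-- (v , k) to the one cut out by (T π v , k).  Everything else is transport
-- along this symmetry.
module Submission where

open import Defs
open import Level using (Level; 0ℓ)
open import Algebra.Structures using (IsCommutativeMonoid)
open import Data.Bool.Base using (true; false; _∧_; _∨_)
open import Data.Fin.Base using (Fin)
import Data.Fin.Properties as Fin
open import Data.Nat.Base as ℕ using (ℕ; zero; suc)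
import Data.Nat.Properties as ℕ
open import Data.Fin.Permutation
  using (Permutation′; _⟨$⟩ʳ_; _⟨$⟩ˡ_; flip; inverseˡ; inverseʳ)
open import Data.Fin.Subset as Sub using (Subset; inside; outside; ⁅_⁆)
import Data.Fin.Subset.Properties as Sub
open import Data.List.Base as List using ([]; _∷_)
import Data.List.Properties as List
import Data.List.Membership.Propositional as List
open import Data.List.Membership.Propositional.Properties
  using (∈-map⁺; ∈-map⁻; ∈-++⁺ˡ; ∈-++⁺ʳ)
open import Data.List.Membership.Propositional.Properties.WithK
  using (unique∧set⇒bag)
open import Data.List.Relation.Binary.BagAndSetEquality using (∼bag⇒↭)
open import Data.List.Relation.Binary.Permutation.Propositional
  using (_↭_; ↭⇒↭ₛ′)
import Data.List.Relation.Binary.Permutation.Propositional.Properties as ↭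
import Data.List.Relation.Binary.Permutation.Setoid.Properties as ↭ₛ
open import Data.List.Relation.Unary.All using ([])
open import Data.List.Relation.Unary.AllPairs using ([]; _∷_)
open import Data.List.Relation.Unary.Any using (here)
open import Data.List.Relation.Unary.Unique.Propositional using (Unique)
import Data.List.Relation.Unary.Unique.Propositional.Properties as Unique
open import Data.Product.Base using (_×_; _,_; proj₁; ∃-syntax)
open import Data.Rational.Base as ℚ using (ℚ; 0ℚ; 1ℚ; ∣_∣; 1/_; Positive)
import Data.Rational.Properties as ℚ
open import Data.Rational.Solver using (module +-*-Solver)
open import Data.Sum.Base using (inj₁; inj₂)
open import Data.Vec.Base as Vec using ([]; _∷_; lookup)
import Data.Vec.Properties as Vec
open import Function.Base using (_∘_; id; case_of_)
open import Function.Bundles using (_⇔_; mk⇔)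
open import Relation.Binary.Bundles using (Setoid)
open import Relation.Binary.PropositionalEquality
  using (_≡_; refl; sym; trans; cong; cong₂; subst; subst₂; module ≡-Reasoning)
open import Relation.Binary.Structures using (IsEquivalence)
import Relation.Binary.Reasoning.Setoid as ≈-Reasoning
open import Relation.Nullary.Decidable using (Dec; does; _×-dec_; dec-true; dec-false)
open import Relation.Unary using (Pred; _∈_; _⊆_; _⊂_; _≐_)
open import Relation.Unary.Properties using (⊂-⊆-trans; ⊆-⊂-trans)

private
  variable
    g f : Level
    n   : ℕ

-- Real numbers

Eventually : Pred ℕ 0ℓ → Set
Eventually P = ∃[ k ] (∀ i → k ℕ.≤ i → P i)

eventually-map : {P Q : Pred ℕ 0ℓ} → P ⊆ Q → Eventually P → Eventually Q
eventually-map P⊆Q (k , p) = k , λ i k≤i → P⊆Q (p i k≤i)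

eventually-zipWith : {P Q R : Pred ℕ 0ℓ} → (∀ {i} → P i → Q i → R i) →
                     Eventually P → Eventually Q → Eventually R
eventually-zipWith h (k , p) (l , q) = k ℕ.⊔ l , λ i k⊔l≤i →
  h (p i (ℕ.m⊔n≤o⇒m≤o k l k⊔l≤i)) (q i (ℕ.m⊔n≤o⇒n≤o k l k⊔l≤i))

module _ where
  open +-*-Solver

  p≡q+[p-q] : ∀ p q → p ≡ q ℚ.+ (p ℚ.- q)
  p≡q+[p-q] = solve 2 (λ p q → p := q :+ (p :- q)) refl

  p-q≡-[q-p] : ∀ p q → p ℚ.- q ≡ ℚ.- (q ℚ.- p)
  p-q≡-[q-p] = solve 2 (λ p q → p :- q := :- (q :- p)) refl

  -p--q≡q-p : ∀ p q → (ℚ.- p) ℚ.- (ℚ.- q) ≡ q ℚ.- p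
  -p--q≡q-p = solve 2 (λ p q → (:- p) :- (:- q) := q :- p) refl

  p-r≡[p-q]+[q-r] : ∀ p q r → p ℚ.- r ≡ (p ℚ.- q) ℚ.+ (q ℚ.- r)
  p-r≡[p-q]+[q-r] = solve 3 (λ p q r → p :- r := (p :- q) :+ (q :- r)) refl

  [p+q]-[r+s]≡[p-r]+[q-s] : ∀ p q r s →
    (p ℚ.+ q) ℚ.- (r ℚ.+ s) ≡ (p ℚ.- r) ℚ.+ (q ℚ.- s)
  [p+q]-[r+s]≡[p-r]+[q-s] =
    solve 4 (λ p q r s → (p :+ q) :- (r :+ s) := (p :- r) :+ (q :- s)) refl

  pr-qr≡r[p-q] : ∀ p q r → p ℚ.* r ℚ.- q ℚ.* r ≡ r ℚ.* (p ℚ.- q)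
  pr-qr≡r[p-q] = solve 3 (λ p q r → p :* r :- q :* r := r :* (p :- q)) refl

∣p-q∣≡∣q-p∣ : ∀ p q → ∣ p ℚ.- q ∣ ≡ ∣ q ℚ.- p ∣
∣p-q∣≡∣q-p∣ p q = trans (cong ∣_∣ (p-q≡-[q-p] p q)) (ℚ.∣-p∣≡∣p∣ (q ℚ.- p))

p≤∣p∣ : ∀ p → p ℚ.≤ ∣ p ∣
p≤∣p∣ p with ℚ.≤-total 0ℚ p
... | inj₁ 0≤p = ℚ.≤-reflexive (sym (ℚ.0≤p⇒∣p∣≡p 0≤p))
... | inj₂ p≤0 = ℚ.≤-trans p≤0 (ℚ.0≤∣p∣ p)

∣p+q∣≤ε : ∀ p q {δ ε} → δ ℚ.+ δ ≡ ε → ∣ p ∣ ℚ.≤ δ → ∣ q ∣ ℚ.≤ δ → ∣ p ℚ.+ q ∣ ℚ.≤ ε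
∣p+q∣≤ε p q {δ} {ε} 2δ≡ε p≤δ q≤δ = begin
  ∣ p ℚ.+ q ∣          ≤⟨ ℚ.∣p+q∣≤∣p∣+∣q∣ p q ⟩
  ∣ p ∣ ℚ.+ ∣ q ∣      ≤⟨ ℚ.+-mono-≤ p≤δ q≤δ ⟩
  δ ℚ.+ δ              ≡⟨ 2δ≡ε ⟩
  ε                    ∎
  where open ℚ.≤-Reasoning

∣p∣≤∣q∣+∣p-q∣ : ∀ p q → ∣ p ∣ ℚ.≤ ∣ q ∣ ℚ.+ ∣ p ℚ.- q ∣
∣p∣≤∣q∣+∣p-q∣ p q = subst (ℚ._≤ ∣ q ∣ ℚ.+ ∣ p ℚ.- q ∣)
  (cong ∣_∣ (sym (p≡q+[p-q] p q))) (ℚ.∣p+q∣≤∣p∣+∣q∣ q (p ℚ.- q))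

∣p-q∣≤ε⇒p≤q+ε : ∀ p q {ε} → ∣ p ℚ.- q ∣ ℚ.≤ ε → p ℚ.≤ q ℚ.+ ε
∣p-q∣≤ε⇒p≤q+ε p q p-q≤ε = ℚ.≤-trans (ℚ.≤-reflexive (p≡q+[p-q] p q))
  (ℚ.+-monoʳ-≤ q (ℚ.≤-trans (p≤∣p∣ (p ℚ.- q)) p-q≤ε))

-- abstract, so that abstracting over their values with `with` does not unfold
-- rational arithmetic
abstract
  divide : ∀ B → 0ℚ ℚ.< B → ∀ ε → 0ℚ ℚ.< ε → ∃[ δ ] (0ℚ ℚ.< δ × B ℚ.* δ ≡ ε)
  divide B 0<B ε 0<ε = 1/ B ℚ.* ε , 0<δ , Bδ≡ε
    where
    instance
      B-positive : Positive B
      B-positive = ℚ.positive 0<B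

      B-nonZero : ℚ.NonZero B
      B-nonZero = ℚ.pos⇒nonZero B

      1/B-positive : Positive (1/ B)
      1/B-positive = ℚ.1/pos⇒pos B

      ε-positive : Positive ε
      ε-positive = ℚ.positive 0<ε

    0<δ : 0ℚ ℚ.< 1/ B ℚ.* ε
    0<δ = ℚ.positive⁻¹ _ {{ℚ.pos*pos⇒pos (1/ B) ε}}

    Bδ≡ε : B ℚ.* (1/ B ℚ.* ε) ≡ ε
    Bδ≡ε = begin
      B ℚ.* (1/ B ℚ.* ε)  ≡⟨ ℚ.*-assoc B (1/ B) ε ⟨
      B ℚ.* 1/ B ℚ.* ε    ≡⟨ cong (ℚ._* ε) (ℚ.*-inverseʳ B) ⟩
      1ℚ ℚ.* ε            ≡⟨ ℚ.*-identityˡ ε ⟩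
      ε                   ∎
      where open ≡-Reasoning

  halve : ∀ ε → 0ℚ ℚ.< ε → ∃[ δ ] (0ℚ ℚ.< δ × δ ℚ.+ δ ≡ ε)
  halve ε 0<ε with divide (1ℚ ℚ.+ 1ℚ) (ℚ.positive⁻¹ _) ε 0<ε
  ... | δ , 0<δ , 2δ≡ε = δ , 0<δ , trans δ+δ≡2δ 2δ≡ε
    where
    open +-*-Solver
    δ+δ≡2δ : δ ℚ.+ δ ≡ (1ℚ ℚ.+ 1ℚ) ℚ.* δ
    δ+δ≡2δ = solve 1 (λ δ → δ :+ δ := (con 1ℚ :+ con 1ℚ) :* δ) refl δ

  -- The Cauchy condition with tolerance 1 keeps every term beyond index `k` within 1 of the `k`-th
  -- term.
  eventuallyBounded : ∀ x → ∃[ B ] (0ℚ ℚ.< B × Eventually λ i → ∣ seq x i ∣ ℚ.≤ B)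
  eventuallyBounded x with cauchy x 1ℚ (ℚ.positive⁻¹ 1ℚ)
  ... | k , close =
    ∣ seq x k ∣ ℚ.+ 1ℚ , ℚ.+-mono-≤-< (ℚ.0≤∣p∣ (seq x k)) (ℚ.positive⁻¹ 1ℚ) ,
    k , λ i k≤i → ℚ.≤-trans (∣p∣≤∣q∣+∣p-q∣ (seq x i) (seq x k))
      (ℚ.+-monoʳ-≤ ∣ seq x k ∣ (close i k k≤i ℕ.≤-refl))

-- For each positive `ε`, `x ≈ y` yields `Eventually (Close x y ε)` and `x ≤ y` yields
-- `Eventually (Below x y ε)`; naming the predicates lets the `Eventually` combinators apply.
Close : ℝ → ℝ → ℚ → Pred ℕ 0ℓ
Close x y ε i = ∣ seq x i ℚ.- seq y i ∣ ℚ.≤ ε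

Below : ℝ → ℝ → ℚ → Pred ℕ 0ℓ
Below x y ε i = seq x i ℚ.≤ seq y i ℚ.+ ε

-- Such reals may still differ in their `cauchy` fields, so they need not be propositionally equal.
-- Laws of rational arithmetic pass to `_≈_` in this way.
≗⇒≈ : ∀ {x y} → (∀ i → seq x i ≡ seq y i) → x ≈ y
≗⇒≈ {x} {y} x≗y ε 0<ε = 0 , λ i _ → ℚ.≤-trans
  (ℚ.≤-reflexive (cong ∣_∣ (trans (cong (ℚ._- seq y i) (x≗y i))
                                  (ℚ.+-inverseʳ (seq y i)))))
  (ℚ.<⇒≤ 0<ε)

-- Unfolding `_≈_` or `_≤_` leaves only `seq`, which does not determine the `cauchy` fields of the
-- endpoints; hence the many implicit arguments that are supplied by hand from here on.
≈-refl : ∀ {x} → x ≈ x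
≈-refl {x} = ≗⇒≈ {x} {x} λ _ → refl

≈-reflexive : ∀ {x y} → x ≡ y → x ≈ y
≈-reflexive {x} refl = ≈-refl {x}

≈-sym : ∀ {x y} → x ≈ y → y ≈ x
≈-sym {x} {y} x≈y ε 0<ε =
  eventually-map {Close x y ε} {Close y x ε}
    (λ {i} → subst (ℚ._≤ ε) (∣p-q∣≡∣q-p∣ (seq x i) (seq y i)))
    (x≈y ε 0<ε)

≈-trans : ∀ {x y z} → x ≈ y → y ≈ z → x ≈ z
≈-trans {x} {y} {z} x≈y y≈z ε 0<ε with halve ε 0<ε
... | δ , 0<δ , 2δ≡ε =
  eventually-zipWith {Close x y δ} {Close y z δ} {Close x z ε} bound (x≈y δ 0<δ) (y≈z δ 0<δ)
  where
  open ℚ.≤-Reasoning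
  bound : ∀ {i} → Close x y δ i → Close y z δ i → Close x z ε i
  bound {i} p q = begin
    ∣ seq x i ℚ.- seq z i ∣
      ≡⟨ cong ∣_∣ (p-r≡[p-q]+[q-r] (seq x i) (seq y i) (seq z i)) ⟩
    ∣ (seq x i ℚ.- seq y i) ℚ.+ (seq y i ℚ.- seq z i) ∣
      ≤⟨ ∣p+q∣≤ε (seq x i ℚ.- seq y i) (seq y i ℚ.- seq z i) 2δ≡ε p q ⟩
    ε ∎

≈-isEquivalence : IsEquivalence _≈_
≈-isEquivalence = record
  { refl  = λ {x} → ≈-refl {x}
  ; sym   = λ {x} {y} → ≈-sym {x} {y}
  ; trans = λ {x} {y} {z} → ≈-trans {x} {y} {z}
  }

≈-setoid : Setoid 0ℓ 0ℓ
≈-setoid = record { isEquivalence = ≈-isEquivalence }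

≈⇒≤ : ∀ {x y} → x ≈ y → x ≤ y
≈⇒≤ {x} {y} x≈y ε 0<ε =
  eventually-map {Close x y ε} {Below x y ε}
    (λ {i} → ∣p-q∣≤ε⇒p≤q+ε (seq x i) (seq y i))
    (x≈y ε 0<ε)

≤-trans : ∀ {x y z} → x ≤ y → y ≤ z → x ≤ z
≤-trans {x} {y} {z} x≤y y≤z ε 0<ε with halve ε 0<ε
... | δ , 0<δ , 2δ≡ε =
  eventually-zipWith {Below x y δ} {Below y z δ} {Below x z ε} bound (x≤y δ 0<δ) (y≤z δ 0<δ)
  where
  open ℚ.≤-Reasoning
  bound : ∀ {i} → Below x y δ i → Below y z δ i → Below x z ε i
  bound {i} p q = begin
    seq x i                 ≤⟨ p ⟩
    seq y i ℚ.+ δ           ≤⟨ ℚ.+-monoˡ-≤ δ q ⟩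
    (seq z i ℚ.+ δ) ℚ.+ δ   ≡⟨ ℚ.+-assoc (seq z i) δ δ ⟩
    seq z i ℚ.+ (δ ℚ.+ δ)   ≡⟨ cong (seq z i ℚ.+_) 2δ≡ε ⟩
    seq z i ℚ.+ ε           ∎

≤-resp-≈ : ∀ {x x′ y y′} → x ≈ x′ → y ≈ y′ → x ≤ y → x′ ≤ y′
≤-resp-≈ {x} {x′} {y} {y′} x≈x′ y≈y′ x≤y =
  ≤-trans {x′} {x} {y′} (≈⇒≤ {x′} {x} (≈-sym {x} {x′} x≈x′))
    (≤-trans {x} {y} {y′} x≤y (≈⇒≤ {y} {y′} y≈y′))

+-cong : ∀ {x x′ y y′} → x ≈ x′ → y ≈ y′ → x + y ≈ x′ + y′
+-cong {x} {x′} {y} {y′} x≈x′ y≈y′ ε 0<ε with halve ε 0<ε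
... | δ , 0<δ , 2δ≡ε =
  eventually-zipWith {Close x x′ δ} {Close y y′ δ} {Close (x + y) (x′ + y′) ε} bound
    (x≈x′ δ 0<δ) (y≈y′ δ 0<δ)
  where
  open ℚ.≤-Reasoning
  bound : ∀ {i} → Close x x′ δ i → Close y y′ δ i → Close (x + y) (x′ + y′) ε i
  bound {i} p q = begin
    ∣ (seq x i ℚ.+ seq y i) ℚ.- (seq x′ i ℚ.+ seq y′ i) ∣
      ≡⟨ cong ∣_∣ ([p+q]-[r+s]≡[p-r]+[q-s] (seq x i) (seq y i) (seq x′ i) (seq y′ i)) ⟩
    ∣ (seq x i ℚ.- seq x′ i) ℚ.+ (seq y i ℚ.- seq y′ i) ∣
      ≤⟨ ∣p+q∣≤ε (seq x i ℚ.- seq x′ i) (seq y i ℚ.- seq y′ i) 2δ≡ε p q ⟩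
    ε ∎

neg-cong : ∀ {x y} → x ≈ y → - x ≈ - y
neg-cong {x} {y} x≈y ε 0<ε = eventually-map {Close x y ε} {Close (- x) (- y) ε}
  (λ {i} → subst (ℚ._≤ ε) (trans (∣p-q∣≡∣q-p∣ (seq x i) (seq y i))
    (cong ∣_∣ (sym (-p--q≡q-p (seq x i) (seq y i))))))
  (x≈y ε 0<ε)

-- The fixed factor is eventually bounded by some `B`, so closeness `δ` with `B δ = ε` suffices for
-- the other factor.
*-congʳ : ∀ z {x y} → x ≈ y → x * z ≈ y * z
*-congʳ z {x} {y} x≈y ε 0<ε with eventuallyBounded z
... | B , 0<B , ∣z∣≤B with divide B 0<B ε 0<ε
... | δ , 0<δ , Bδ≡ε =
  eventually-zipWith {λ i → ∣ seq z i ∣ ℚ.≤ B} {Close x y δ} {Close (x * z) (y * z) ε} bound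
    ∣z∣≤B (x≈y δ 0<δ)
  where
  open ℚ.≤-Reasoning
  bound : ∀ {i} → ∣ seq z i ∣ ℚ.≤ B → Close x y δ i → Close (x * z) (y * z) ε i
  bound {i} z≤B d≤δ = begin
    ∣ seq x i ℚ.* seq z i ℚ.- seq y i ℚ.* seq z i ∣
      ≡⟨ cong ∣_∣ (pr-qr≡r[p-q] (seq x i) (seq y i) (seq z i)) ⟩
    ∣ seq z i ℚ.* d ∣    ≡⟨ ℚ.∣p*q∣≡∣p∣*∣q∣ (seq z i) d ⟩
    ∣ seq z i ∣ ℚ.* ∣ d ∣ ≤⟨ ℚ.*-monoʳ-≤-nonNeg ∣ d ∣ {{ℚ.∣-∣-nonNeg d}} z≤B ⟩
    B ℚ.* ∣ d ∣          ≤⟨ ℚ.*-monoˡ-≤-nonNeg B {{ℚ.nonNegative (ℚ.<⇒≤ 0<B)}} d≤δ ⟩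
    B ℚ.* δ              ≡⟨ Bδ≡ε ⟩
    ε                    ∎
    where d = seq x i ℚ.- seq y i

-- Finite sums of reals.

+-isCommutativeMonoid : IsCommutativeMonoid _≈_ _+_ 0ℝ
+-isCommutativeMonoid = record
  { isMonoid = record
    { isSemigroup = record
      { isMagma = record
        { isEquivalence = ≈-isEquivalence
        ; ∙-cong        = λ {x} {x′} {y} {y′} → +-cong {x} {x′} {y} {y′}
        }
      ; assoc = λ x y z → ≗⇒≈ {(x + y) + z} {x + (y + z)}
          λ i → ℚ.+-assoc (seq x i) (seq y i) (seq z i)
      }
    ; identity = (λ x → ≗⇒≈ {0ℝ + x} {x} λ i → ℚ.+-identityˡ (seq x i))
               , (λ x → ≗⇒≈ {x + 0ℝ} {x} λ i → ℚ.+-identityʳ (seq x i))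
    }
  ; comm = λ x y → ≗⇒≈ {x + y} {y + x} λ i → ℚ.+-comm (seq x i) (seq y i)
  }

-- A fold in a commutative monoid does not depend on the order of the list.
sum-↭ : ∀ {xs ys} → xs ↭ ys → List.foldr _+_ 0ℝ xs ≈ List.foldr _+_ 0ℝ ys
sum-↭ xs↭ys = ↭ₛ.foldr-commMonoid ≈-setoid +-isCommutativeMonoid
  (↭⇒↭ₛ′ ≈-isEquivalence xs↭ys)

sum-cong : ∀ {A : Set} (h k : A → ℝ) → (∀ a → h a ≈ k a) → ∀ as →
  List.foldr _+_ 0ℝ (List.map h as) ≈ List.foldr _+_ 0ℝ (List.map k as)
sum-cong h k h≈k []       = ≈-refl {0ℝ}
sum-cong h k h≈k (a ∷ as) =
  +-cong {h a} {k a}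
    {List.foldr _+_ 0ℝ (List.map h as)} {List.foldr _+_ 0ℝ (List.map k as)}
    (h≈k a) (sum-cong h k h≈k as)

-- Images of subsets

lookup-injective : (A B : Subset n) → (∀ i → lookup A i ≡ lookup B i) → A ≡ B
lookup-injective A B A≗B = begin
  A                        ≡⟨ Vec.tabulate∘lookup A ⟨
  Vec.tabulate (lookup A)  ≡⟨ Vec.tabulate-cong A≗B ⟩
  Vec.tabulate (lookup B)  ≡⟨ Vec.tabulate∘lookup B ⟩
  B                        ∎
  where open ≡-Reasoning

module _ (π : Permutation′ n) where

  -- As `π` is bijective, the only candidate for a preimage of `j` is its inverse image. This
  -- replaces the search in the definition of `image` by a formula that can be checked pointwise.
  lookup-image : ∀ S j → lookup (image π S) j ≡ lookup S (π ⟨$⟩ˡ j)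
  lookup-image S j = trans (Vec.lookup∘tabulate (does ∘ preimage?) j) (decides j)
    where
    preimage? : ∀ j → Dec (∃[ i ] (i Sub.∈ S × π ⟨$⟩ʳ i ≡ j))
    preimage? j = Fin.any? λ i → (i Sub.∈? S) ×-dec ((π ⟨$⟩ʳ i) Fin.≟ j)

    decides : ∀ j → does (preimage? j) ≡ lookup S (π ⟨$⟩ˡ j)
    decides j with lookup S (π ⟨$⟩ˡ j) in eq
    ... | true  = dec-true (preimage? j)
      (π ⟨$⟩ˡ j , Vec.lookup⇒[]= _ S eq , inverseʳ π)
    -- Any `i` in `S` with `π ⟨$⟩ʳ i` equal to `j` is the inverse image of `j`, which `eq` places
    -- outside `S`.
    ... | false = dec-false (preimage? j) λ where
      (i , i∈S , refl) → case trans (sym (Vec.[]=⇒lookup i∈S))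
        (trans (cong (lookup S) (sym (inverseˡ π))) eq) of λ ()

  -- Union and intersection both act coordinatewise, and `image` only permutes coordinates, so one
  -- argument covers both.
  image-zipWith : ∀ _∙_ A B →
    image π (Vec.zipWith _∙_ A B) ≡ Vec.zipWith _∙_ (image π A) (image π B)
  image-zipWith _∙_ A B = lookup-injective _ _ λ j → begin
    lookup (image π (Vec.zipWith _∙_ A B)) j
      ≡⟨ lookup-image (Vec.zipWith _∙_ A B) j ⟩
    lookup (Vec.zipWith _∙_ A B) (π ⟨$⟩ˡ j)
      ≡⟨ Vec.lookup-zipWith _∙_ (π ⟨$⟩ˡ j) A B ⟩
    lookup A (π ⟨$⟩ˡ j) ∙ lookup B (π ⟨$⟩ˡ j)
      ≡⟨ cong₂ _∙_ (lookup-image A j) (lookup-image B j) ⟨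
    lookup (image π A) j ∙ lookup (image π B) j
      ≡⟨ Vec.lookup-zipWith _∙_ j (image π A) (image π B) ⟨
    lookup (Vec.zipWith _∙_ (image π A) (image π B)) j
      ∎
    where open ≡-Reasoning

  image-∪ : ∀ A B → image π (A Sub.∪ B) ≡ image π A Sub.∪ image π B
  image-∪ = image-zipWith _∨_

  image-∩ : ∀ A B → image π (A Sub.∩ B) ≡ image π A Sub.∩ image π B
  image-∩ = image-zipWith _∧_

  image-⁅⁆ : ∀ a → image π ⁅ a ⁆ ≡ ⁅ π ⟨$⟩ʳ a ⁆
  image-⁅⁆ a = Sub.⊆-antisym
    (λ {j} j∈ → subst (Sub._∈ ⁅ π ⟨$⟩ʳ a ⁆)
      (trans (cong (π ⟨$⟩ʳ_) (sym (Sub.x∈⁅y⁆⇒x≡y a (Vec.lookup⇒[]= _ ⁅ a ⁆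
        (trans (sym (lookup-image ⁅ a ⁆ j)) (Vec.[]=⇒lookup j∈))))))
        (inverseʳ π))
      (Sub.x∈⁅x⁆ (π ⟨$⟩ʳ a)))
    (λ {j} j∈ → Vec.lookup⇒[]= j _ (trans (lookup-image ⁅ a ⁆ j)
      (Vec.[]=⇒lookup (subst (Sub._∈ ⁅ a ⁆)
        (sym (trans (cong (π ⟨$⟩ˡ_) (Sub.x∈⁅y⁆⇒x≡y _ j∈)) (inverseˡ π)))
        (Sub.x∈⁅x⁆ a)))))

  -- The shape of the sets in an independence condition; it is used twice for the union of two
  -- singletons and `C`.
  image-⁅⁆-∪ : ∀ a D → image π (⁅ a ⁆ Sub.∪ D) ≡ ⁅ π ⟨$⟩ʳ a ⁆ Sub.∪ image π D
  image-⁅⁆-∪ a D = trans (image-∪ ⁅ a ⁆ D) (cong (Sub._∪ image π D) (image-⁅⁆ a))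

-- Taken at `flip π`, this also gives the other composite: `image` uses only the forward map, and
-- that of `flip (flip π)` computes to that of `π`.
image-flip : (π : Permutation′ n) (S : Subset n) → image (flip π) (image π S) ≡ S
image-flip π S = lookup-injective _ _ λ j → begin
  lookup (image (flip π) (image π S)) j ≡⟨ lookup-image (flip π) (image π S) j ⟩
  lookup (image π S) (π ⟨$⟩ʳ j)         ≡⟨ lookup-image π S (π ⟨$⟩ʳ j) ⟩
  lookup S (π ⟨$⟩ˡ (π ⟨$⟩ʳ j))          ≡⟨ cong (lookup S) (inverseˡ π) ⟩
  lookup S j                            ∎
  where open ≡-Reasoning

image-injective : (π : Permutation′ n) {A B : Subset n} → image π A ≡ image π B → A ≡ B
image-injective π {A} {B} eq =
  trans (sym (image-flip π A)) (trans (cong (image (flip π)) eq) (image-flip π B))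

-- The list of all subsets.

subsets-complete : (S : Subset n) → S List.∈ subsets n
subsets-complete []            = here refl
subsets-complete (outside ∷ S) = ∈-++⁺ˡ (∈-map⁺ (outside ∷_) (subsets-complete S))
subsets-complete (inside  ∷ S) = ∈-++⁺ʳ _ (∈-map⁺ (inside ∷_) (subsets-complete S))

subsets-unique : ∀ n → Unique (subsets n)
subsets-unique zero    = [] ∷ []
subsets-unique (suc n) = Unique.++⁺
  (Unique.map⁺ Vec.∷-injectiveʳ (subsets-unique n))
  (Unique.map⁺ Vec.∷-injectiveʳ (subsets-unique n))
  -- The two halves of the list are disjoint because their members differ at the head.
  λ (S∈outside , S∈inside) → case ∈-map⁻ _ S∈outside , ∈-map⁻ _ S∈inside of λ where
    ((_ , _ , refl) , (_ , _ , ()))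

-- Both lists are free of repetitions and contain every subset. Duplicate-free lists with the same
-- members agree as bags, hence up to reordering.
image-subsets-↭ : (π : Permutation′ n) → List.map (image π) (subsets n) ↭ subsets n
image-subsets-↭ {n} π = ∼bag⇒↭ (unique∧set⇒bag
  (Unique.map⁺ (image-injective π) (subsets-unique n)) (subsets-unique n)
  λ {S} → mk⇔ (λ _ → subsets-complete S)
    (λ _ → subst (List._∈ _) (image-flip (flip π) S)
      (∈-map⁺ (image π) (subsets-complete (image (flip π) S)))))

-- Set functions

≋-refl : {m : ℝ^𝒫 n} → m ≋ m
≋-refl {m = m} S = ≈-refl {m S}

≋-sym : {m u : ℝ^𝒫 n} → m ≋ u → u ≋ m
≋-sym {m = m} {u} m≋u S = ≈-sym {m S} {u S} (m≋u S)

≋-trans : {m u w : ℝ^𝒫 n} → m ≋ u → u ≋ w → m ≋ w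
≋-trans {m = m} {u} {w} m≋u u≋w S = ≈-trans {m S} {u S} {w S} (m≋u S) (u≋w S)

⟨⟩-congʳ : (v : ℝ^𝒫 n) {m u : ℝ^𝒫 n} → m ≋ u → ⟨ m , v ⟩ ≈ ⟨ u , v ⟩
⟨⟩-congʳ {n} v {m} {u} m≋u = sum-cong (λ A → m A * v A) (λ A → u A * v A)
  (λ A → *-congʳ (v A) {m A} {u A} (m≋u A)) (subsets n)

-- Change of summation variable along the bijection `image π` of the power set.
sum-image : (π : Permutation′ n) (h : Subset n → ℝ) →
  List.foldr _+_ 0ℝ (List.map (λ A → h (image π A)) (subsets n)) ≈
  List.foldr _+_ 0ℝ (List.map h (subsets n))
sum-image {n} π h = begin
  List.foldr _+_ 0ℝ (List.map (λ A → h (image π A)) (subsets n))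
    ≡⟨ cong (List.foldr _+_ 0ℝ) (List.map-∘ {g = h} {f = image π} (subsets n)) ⟩
  List.foldr _+_ 0ℝ (List.map h (List.map (image π) (subsets n)))
    ≈⟨ sum-↭ {List.map h (List.map (image π) (subsets n))} {List.map h (subsets n)}
         (↭.map⁺ h (image-subsets-↭ π)) ⟩
  List.foldr _+_ 0ℝ (List.map h (subsets n)) ∎
  where open ≈-Reasoning ≈-setoid

-- T is unfolded under seq only: comparing the two products as reals would
-- normalise their proofs of convergence.
⟨⟩-T : (π : Permutation′ n) (m u : ℝ^𝒫 n) → ⟨ T π m , T π u ⟩ ≈ ⟨ m , u ⟩
⟨⟩-T {n} π m u = begin
  ⟨ T π m , T π u ⟩
    ≈⟨ sum-cong (λ A → T π m A * T π u A) (λ A → m (image π A) * u (image π A))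
         (λ A → ≗⇒≈ {T π m A * T π u A} {m (image π A) * u (image π A)} λ i → refl)
         (subsets n) ⟩
  List.foldr _+_ 0ℝ (List.map (λ A → m (image π A) * u (image π A)) (subsets n))
    ≈⟨ sum-image π (λ A → m A * u A) ⟩
  ⟨ m , u ⟩ ∎
  where open ≈-Reasoning ≈-setoid

T-cong : (π : Permutation′ n) {m u : ℝ^𝒫 n} → m ≋ u → T π m ≋ T π u
T-cong π m≋u S = m≋u (image π S)

T-flip : (π : Permutation′ n) (m : ℝ^𝒫 n) → T π (T (flip π) m) ≋ m
T-flip π m S = ≈-reflexive (cong m (image-flip π S))

T-cancel : (π : Permutation′ n) {m u : ℝ^𝒫 n} → T π m ≋ u → m ≋ T (flip π) u
T-cancel π {m} {u} Tm≋u = ≋-trans {m = m} {T (flip π) (T π m)} {T (flip π) u}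
  (≋-sym {m = T (flip π) (T π m)} {m} (T-flip (flip π) m))
  (T-cong (flip π) {T π m} {u} Tm≋u)

-- Phrased for any `u` with `T π m ≋ u`, since members of `T[ π ] G` are given in that form. With
-- `m` taken as `T (flip π) u` it moves the transformation from one argument to the other.
⟨⟩-adjoint : (π : Permutation′ n) {m u : ℝ^𝒫 n} (v : ℝ^𝒫 n) → T π m ≋ u →
  ⟨ m , v ⟩ ≈ ⟨ u , T π v ⟩
⟨⟩-adjoint π {m} {u} v Tm≋u = begin
  ⟨ m , v ⟩          ≈⟨ ⟨⟩-T π m v ⟨
  ⟨ T π m , T π v ⟩  ≈⟨ ⟨⟩-congʳ (T π v) {T π m} {u} Tm≋u ⟩
  ⟨ u , T π v ⟩      ∎
  where open ≈-Reasoning ≈-setoid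

-- Supermodularity, modularity and independence.

𝓚-extensional : Extensional (𝓚 {n})
𝓚-extensional {m = m} {u} m≋u m∈𝓚 A B = ≤-resp-≈
  {m A + m B} {u A + u B}
  {m (A Sub.∪ B) + m (A Sub.∩ B)} {u (A Sub.∪ B) + u (A Sub.∩ B)}
  (+-cong {m A} {u A} {m B} {u B} (m≋u A) (m≋u B))
  (+-cong {m (A Sub.∪ B)} {u (A Sub.∪ B)} {m (A Sub.∩ B)} {u (A Sub.∩ B)}
    (m≋u (A Sub.∪ B)) (m≋u (A Sub.∩ B)))
  (m∈𝓚 A B)

-- The inequality at `A` and `B` is the one for `m` at their images, because `image π` commutes with
-- union and intersection.
T-𝓚 : (π : Permutation′ n) {m : ℝ^𝒫 n} → m ∈ 𝓚 → T π m ∈ 𝓚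
T-𝓚 π {m} m∈𝓚 A B = subst₂
  (λ X Y → m (image π A) + m (image π B) ≤ m X + m Y)
  (sym (image-∪ π A B)) (sym (image-∩ π A B)) (m∈𝓚 (image π A) (image π B))

T-𝓚⁻¹ : (π : Permutation′ n) {m : ℝ^𝒫 n} → T π m ∈ 𝓚 → m ∈ 𝓚
T-𝓚⁻¹ π {m} Tm∈𝓚 =
  𝓚-extensional {m = T (flip π) (T π m)} {m} (T-flip (flip π) m) (T-𝓚 (flip π) {T π m} Tm∈𝓚)

Modular-extensional : Extensional (Modular {n})
Modular-extensional {m = m} {u} m≋u (m∈𝓚 , -m∈𝓚) =
  𝓚-extensional {m = m} {u} m≋u m∈𝓚 ,
  𝓚-extensional {m = neg m} {neg u} (λ S → neg-cong {m S} {u S} (m≋u S)) -m∈𝓚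

-- The two conditions evaluate `m` at propositionally equal subsets, so they are equal as types. The
-- term at `C` agrees by definition; the other three are rewritten.
T-⊥ : (π : Permutation′ n) (m : ℝ^𝒫 n) (a b : Fin n) (C : Subset n) →
  (a ⊥ b ∣ C [ T π m ]) ≡ ((π ⟨$⟩ʳ a) ⊥ (π ⟨$⟩ʳ b) ∣ image π C [ m ])
T-⊥ π m a b C = conditions-≡ (m (image π C))
  (cong m (trans (image-⁅⁆-∪ π a (⁅ b ⁆ Sub.∪ C))
                 (cong (⁅ π ⟨$⟩ʳ a ⁆ Sub.∪_) (image-⁅⁆-∪ π b C))))
  (cong m (image-⁅⁆-∪ π a C))
  (cong m (image-⁅⁆-∪ π b C))
  where
  conditions-≡ : ∀ y {x x′ z z′ w w′} → x ≡ x′ → z ≡ z′ → w ≡ w′ →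
    (x + y - z - w ≈ 0ℝ) ≡ (x′ + y - z′ - w′ ≈ 0ℝ)
  conditions-≡ _ refl refl refl = refl

-- Sets of functions

T[]-mono : (π : Permutation′ n) {G : Pred (ℝ^𝒫 n) g} {F : Pred (ℝ^𝒫 n) f} →
  G ⊆ F → (T[ π ] G) ⊆ (T[ π ] F)
T[]-mono π G⊆F (m , m∈G , Tm≋u) = m , G⊆F m∈G , Tm≋u

∈-T[] : (π : Permutation′ n) {G : Pred (ℝ^𝒫 n) g} {m : ℝ^𝒫 n} → m ∈ G → T π m ∈ T[ π ] G
∈-T[] π {m = m} m∈G = m , m∈G , ≋-refl {m = T π m}

-- The double image consists of the functions related by `_≋_` to a member of `G`; extensionality
-- brings them back into `G`.
T[]-flip⊆ : (π : Permutation′ n) {G : Pred (ℝ^𝒫 n) g} → Extensional G →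
  (T[ π ] (T[ flip π ] G)) ⊆ G
T[]-flip⊆ π G-ext {u} (m , (w , w∈G , Tw≋m) , Tm≋u) = G-ext
  (≋-trans {m = w} {T π m} {u} (T-cancel (flip π) {w} {m} Tw≋m) Tm≋u) w∈G

T[]-flip⊇ : (π : Permutation′ n) {G : Pred (ℝ^𝒫 n) g} → G ⊆ (T[ π ] (T[ flip π ] G))
T[]-flip⊇ π {x = u} u∈G =
  T (flip π) u , ∈-T[] (flip π) u∈G , T-flip π u

-- Take images under `flip π` on both sides and cancel.
T[]-⊆⁻¹ : (π : Permutation′ n) {G : Pred (ℝ^𝒫 n) g} {F : Pred (ℝ^𝒫 n) f} →
  Extensional F → (T[ π ] G) ⊆ (T[ π ] F) → G ⊆ F
T[]-⊆⁻¹ π {G} {F} F-ext TG⊆TF {m} m∈G =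
  T[]-flip⊆ (flip π) {F} (λ {u} {w} → F-ext {u} {w}) {m}
    (T[]-mono (flip π) {T[ π ] G} {T[ π ] F} (λ {u} → TG⊆TF {u}) {m}
      (T[]-flip⊇ (flip π) {G} {m} m∈G))

T[]-⊂ : (π : Permutation′ n) {G : Pred (ℝ^𝒫 n) g} {F : Pred (ℝ^𝒫 n) f} →
  Extensional G → G ⊂ F → (T[ π ] G) ⊂ (T[ π ] F)
T[]-⊂ π {G} {F} G-ext (G⊆F , F⊈G) =
  (λ {m} → T[]-mono π {G} {F} G⊆F {m}) ,
  -- A reverse inclusion between the images would cancel to one between `F` and `G`.
  λ TF⊆TG → F⊈G (T[]-⊆⁻¹ π {F} {G} (λ {u} {w} → G-ext {u} {w}) (λ {u} → TF⊆TG {u}))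

T[]-𝓚 : (π : Permutation′ n) → (T[ π ] 𝓚) ≐ 𝓚
T[]-𝓚 π = (λ {u} (m , m∈𝓚 , Tm≋u) →
              𝓚-extensional {m = T π m} {u} Tm≋u (T-𝓚 π {m} m∈𝓚))
        , λ {u} u∈𝓚 → T (flip π) u , T-𝓚 (flip π) {u} u∈𝓚 , T-flip π u

-- `neg (T π m)` is `T π (neg m)` by definition, so preservation of `𝓚` applies to both conditions.
T[]-Modular⊆ : (π : Permutation′ n) → (T[ π ] Modular) ⊆ Modular
T[]-Modular⊆ π {u} (m , (m∈𝓚 , -m∈𝓚) , Tm≋u) =
  Modular-extensional {m = T π m} {u} Tm≋u (T-𝓚 π {m} m∈𝓚 , T-𝓚 π {neg m} -m∈𝓚)

T[]-Modular⊇ : (π : Permutation′ n) → Modular ⊆ (T[ π ] Modular)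
T[]-Modular⊇ π {m} m∈ =
  T[]-mono π {T[ flip π ] Modular} {Modular} (λ {u} → T[]-Modular⊆ (flip π) {u}) {m}
    (T[]-flip⊇ π {Modular} {m} m∈)

Modular⊂T[] : (π : Permutation′ n) {F : Pred (ℝ^𝒫 n) f} → Modular ⊂ F → Modular ⊂ (T[ π ] F)
Modular⊂T[] π {F} Modular⊂F =
  ⊆-⊂-trans {i = Modular} {T[ π ] Modular} {T[ π ] F} (λ {m} → T[]-Modular⊇ π {m})
    (T[]-⊂ π {Modular} {F} (λ {m} {u} → Modular-extensional {m = m} {u}) Modular⊂F)

-- Faces

-- Membership in a face depends on `m` only through `𝓚` and the value of `⟨ m , v ⟩`, and both
-- respect `_≋_`. This allows double images of faces to be cancelled.
face-extensional : {F : Pred (ℝ^𝒫 n) f} → F IsFaceOf 𝓚 → Extensional F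
face-extensional (v , k , _ , F⊆ , ⊆F) {m} {u} m≋u m∈F =
  let m∈𝓚 , k≈⟨m,v⟩ = F⊆ m∈F in ⊆F (𝓚-extensional {m = m} {u} m≋u m∈𝓚 ,
  ≈-trans {k} {⟨ m , v ⟩} {⟨ u , v ⟩} k≈⟨m,v⟩ (⟨⟩-congʳ v {m} {u} m≋u))

T[]-face : (π : Permutation′ n) {F : Pred (ℝ^𝒫 n) f} → F IsFaceOf 𝓚 → (T[ π ] F) IsFaceOf 𝓚
T[]-face π {F} (v , k , k≤ , F⊆ , ⊆F) =
  T π v , k , bound , (λ {u} → TF⊆ {u}) , (λ {u} → ⊆TF {u})
  where
  bound : ∀ u → u ∈ 𝓚 → k ≤ ⟨ u , T π v ⟩
  -- The bound for `v` is applied to the preimage `T (flip π) u`, which is again supermodular.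
  bound u u∈𝓚 = ≤-resp-≈ {k} {k} {⟨ T (flip π) u , v ⟩} {⟨ u , T π v ⟩}
    (≈-refl {k}) (⟨⟩-adjoint π {T (flip π) u} {u} v (T-flip π u))
    (k≤ (T (flip π) u) (T-𝓚 (flip π) {u} u∈𝓚))

  TF⊆ : ∀ {u} → u ∈ (T[ π ] F) → u ∈ 𝓚 × k ≈ ⟨ u , T π v ⟩
  TF⊆ {u} (m , m∈F , Tm≋u) = let m∈𝓚 , k≈⟨m,v⟩ = F⊆ m∈F in
    𝓚-extensional {m = T π m} {u} Tm≋u (T-𝓚 π {m} m∈𝓚) ,
    ≈-trans {k} {⟨ m , v ⟩} {⟨ u , T π v ⟩} k≈⟨m,v⟩ (⟨⟩-adjoint π {m} {u} v Tm≋u)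

  ⊆TF : ∀ {u} → u ∈ 𝓚 × k ≈ ⟨ u , T π v ⟩ → u ∈ (T[ π ] F)
  ⊆TF {u} (u∈𝓚 , k≈) = T (flip π) u , ⊆F {T (flip π) u} (T-𝓚 (flip π) {u} u∈𝓚 ,
    ≈-trans {k} {⟨ u , T π v ⟩} {⟨ T (flip π) u , v ⟩} k≈
      (≈-sym {⟨ T (flip π) u , v ⟩} {⟨ u , T π v ⟩}
        (⟨⟩-adjoint π {T (flip π) u} {u} v (T-flip π u)))) , T-flip π u

T[]-nonEmptyFace : (π : Permutation′ n) {F : Pred (ℝ^𝒫 n) f} →
  IsNonEmptyFace F → IsNonEmptyFace (T[ π ] F)
T[]-nonEmptyFace π (F-face , m , m∈F) = T[]-face π F-face , T π m , ∈-T[] π m∈F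

-- A face strictly between `Modular` and `T[ π ] F` would be carried by `flip π` to one strictly
-- between `Modular` and `F`.
T[]-atom : (π : Permutation′ n) {F : Pred (ℝ^𝒫 n) 0ℓ} → IsAtom F → IsAtom (T[ π ] F)
T[]-atom π {F} (F-face , Modular⊂F , F-minimal) =
  T[]-nonEmptyFace π F-face , Modular⊂T[] π Modular⊂F ,
  λ (G , G-face , Modular⊂G , G⊂TF) → F-minimal
    ( T[ flip π ] G
    , T[]-nonEmptyFace (flip π) G-face
    , Modular⊂T[] (flip π) Modular⊂G
    , ⊂-⊆-trans {i = T[ flip π ] G} {T[ flip π ] (T[ π ] F)} {F}
        (T[]-⊂ (flip π) {G} {T[ π ] F}
          (λ {u} {w} → face-extensional (proj₁ G-face) {u} {w}) G⊂TF)
        (λ {u} → T[]-flip⊆ (flip π) {F}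
          (λ {u} {w} → face-extensional (proj₁ F-face) {u} {w}) {u}))

-- If a face `G` contains `T π m`, then `T[ flip π ] G` is a face containing `m`, so it includes
-- `F`; applying `T[ π ]` and cancelling puts `T[ π ] F` inside `G`.
T[]-smallestFace : (π : Permutation′ n) {m : ℝ^𝒫 n} {F : Pred (ℝ^𝒫 n) 0ℓ} →
  IsSmallestFaceContaining m F → IsSmallestFaceContaining (T π m) (T[ π ] F)
T[]-smallestFace π {m} {F} (F-face , m∈F , F-least) =
  T[]-face π F-face , ∈-T[] π m∈F , λ G G-face Tm∈G {u} u∈TF →
    T[]-flip⊆ π {G} (λ {m} {w} → face-extensional G-face {m} {w}) {u}
      (T[]-mono π {F} {T[ flip π ] G}
        (λ {w} → F-least (T[ flip π ] G) (T[]-face (flip π) G-face)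
          (T π m , Tm∈G , T-flip (flip π) m) {w})
        {u} u∈TF)

T-extreme : (π : Permutation′ n) {m : ℝ^𝒫 n} → Extreme m → Extreme (T π m)
T-extreme π (F , F-smallest , F-atom) =
  T[ π ] F , T[]-smallestFace π F-smallest , T[]-atom π F-atom

-- The same face `F` serves for both functions, since a face contains one exactly when it contains
-- the other.
extreme-extensional : Extensional (Extreme {n})
extreme-extensional {m = m} {u} m≋u (F , (F-face , m∈F , F-least) , F-atom) =
  F , (F-face , face-extensional F-face m≋u m∈F , λ G G-face u∈G →
    F-least G G-face (face-extensional G-face (≋-sym {m = m} {u} m≋u) u∈G)) , F-atom

mainTheorem1 : {g f : Level} (n : ℕ) → 2 ℕ.≤ n → (π : Permutation′ n) (m : ℝ^𝒫 n) →
    ( (m ∈ 𝓚 ⇔ T π m ∈ 𝓚)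
    × ((t : 𝓔 n) → let open 𝓔 t in
    t ∈ independencyModel (T π m) ⇔ (π ⟨$⟩ʳ a) ⊥ (π ⟨$⟩ʳ b) ∣ image π C [ m ])
    × (T[ π ] 𝓚) ≐ 𝓚 {n} )
    ×
    ( ((F : Pred (ℝ^𝒫 n) f) → F IsFaceOf 𝓚 → (T[ π ] F) IsFaceOf 𝓚)
    × ((G : Pred (ℝ^𝒫 n) g) (F : Pred (ℝ^𝒫 n) f) → Extensional G → Extensional F →
    (G ⊆ F ⇔ (T[ π ] G) ⊆ (T[ π ] F)))
    × (m ∈ 𝓚 → (Extreme m ⇔ Extreme (T π m))) )
mainTheorem1 n _ π m =
  ( mk⇔ (T-𝓚 π {m}) (T-𝓚⁻¹ π {m})
  , (λ (triplet a b C _ _ _) →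
      mk⇔ (subst id (T-⊥ π m a b C)) (subst id (sym (T-⊥ π m a b C))))
  , T[]-𝓚 π )
  ,
  ( (λ F → T[]-face π)
  , (λ G F _ F-ext → mk⇔ {A = G ⊆ F} {B = (T[ π ] G) ⊆ (T[ π ] F)}
      (λ G⊆F {u} → T[]-mono π {G} {F} G⊆F {u})
      (λ TG⊆TF {u} → T[]-⊆⁻¹ π {G} {F} (λ {u} {w} → F-ext {u} {w}) (λ {u} → TG⊆TF {u}) {u}))
  , λ _ → mk⇔ (T-extreme π {m})
      -- The converse is the forward direction for `flip π` at `T π m`, which returns `m` up to
      -- `_≋_`.
      (λ Tm-extreme → extreme-extensional {m = T (flip π) (T π m)} {m} (T-flip (flip π) m)
        (T-extreme (flip π) {T π m} Tm-extreme)) )
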